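{- Let $n\ge1$, let $\sigma,\tau,\pi\in\mathcal{D}_n$, and let $f$ be an oriented TFPL configuration with boundaries $\sigma,\tau,\pi$. For $i\in\{1,\dots,2n-1\}$ let $N_i(f)$ be the number of oriented edges of $f$ that are directed from a vertex of $O_i$ to a vertex of $E_i$, and set $N_0(f)=0$. Then $$N_i(f)-N_{i-1}(f)=\pi_i-\sigma_i\qquad\text{for } i=1,\dots,2n-1.$$
   Context: $\mathcal{D}_n$ is the set of words $\sigma=\sigma_1\cdots\sigma_{2n}$ on the alphabet $\{0,1\}$ with $n$ zeros and $n$ ones such that each prefix contains at least as many $0$s as $1$s. **The triangle.** $\mathcal{T}^n$ is the graph with vertices $(x,y)\in\mathbb{Z}^2$, $x\ge y\ge 0$, $x+y\le 4n-2$, with all unit horizontal and vertical edges between these vertices, together with $2n$ external (half-)edges: the $i$th one hangs vertically below the vertex $(2i-2,0)$, $i=1,\dots,2n$, and is attached to this vertex only. The left boundary vertices are $L_i=(i-1,i-1)$ and the right boundary vertices are $R_i=(2n-2+i,2n-i)$, $i=1,\dots,2n$ (so $L_{2n}=R_1$). For $i\in\{1,\dots,2n\}$, $E_i$ is the set of vertices of $\mathcal{T}^n$ with $x+y=2i-2$; for $i\in\{1,\dots,2n-1\}$, $O_i$ is the set of vertices with $x+y=2i-1$. **Oriented TFPL configurations.** For $\sigma,\tau,\pi\in\mathcal{D}_n$, an oriented TFPL configuration with boundaries $\sigma,\tau,\pi$ is a subgraph $f$ of $\mathcal{T}^n$ with an orientation of each of its edges, such that: - all $2n$ external edges belong to $f$,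 the $i$th one being oriented upwards if $\pi_i=0$ and downwards if $\pi_i=1$; - for $1\le i\le 2n-1$ the horizontal edge from $L_i$ to its right neighbour is in $f$, oriented to the right; for $2\le i\le 2n$ the vertical edge just below $L_i$ is in $f$ if and only if $\sigma_i=0$, and is then oriented upwards; - for $2\le i\le 2n$ the horizontal edge between $R_i$ and its left neighbour is in $f$, oriented to the right; for $1\le i\le 2n-1$ the vertical edge just below $R_i$ is in $f$ if and only if $\tau_i=1$, and is then oriented downwards; - every vertex other than the $L_i$ and $R_i$ has exactly one incoming and exactly one outgoing edge in $f$. (No condition on how paths connect the boundary points is imposed.) -}

module Defs where

open import Data.Fin as Fin using (Fin; toℕ)
open import Data.Fin.Patterns using (0F; 1F)
open import Data.List using (List; _++_; map; filter; length; take; upTo; cartesianProduct)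
open import Data.List.Membership.Propositional using (_∈_)
open import Data.List.Membership.Propositional.Properties
  using (∈-map⁻; ∈-++⁻; ∈-filter⁺; ∈-cartesianProduct⁺; ∈-upTo⁺)
open import Data.List.Relation.Unary.Unique.Propositional using (Unique)
import Data.List.Relation.Unary.Unique.Propositional.Properties as Unique
open import Data.Maybe using (Maybe; just; nothing; _>>=_)
import Data.Maybe.Properties as Maybe
open import Data.Maybe.Relation.Unary.Any as MaybeAny using () renaming (Any to AnyJust)
open import Data.Nat using (ℕ; zero; suc; _+_; _*_; _∸_; _≤_; _<_; _≤?_; _≟_; z≤n; s≤s)
open import Data.Nat.Properties using (suc-injective; ≤-trans; m∸n≤m; m+n≤o⇒m≤o; m+n≤o⇒n≤o)
open import Data.Product using (_×_; _,_)
import Data.Product.Properties as Product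
open import Data.Sum using (inj₁; inj₂)
open import Data.Vec using (Vec; lookup; toList)
open import Function using (case_of_)
open import Relation.Binary using (DecidableEquality)
open import Relation.Binary.PropositionalEquality using (_≡_; _≢_; refl)
open import Relation.Nullary using (¬_)
open import Relation.Nullary.Decidable using (_×-dec_)
open import Relation.Unary using (Decidable)

-- Letters are indexed from 1: an index i ∈ {1,…,m} is  pos j  for a
-- unique  j : Fin m.
pos : ∀ {m} → Fin m → ℕ
pos j = suc (toℕ j)

#[_] : Fin 2 → List (Fin 2) → ℕ
#[ a ] w = length (filter (a Fin.≟_) w)

record 𝒟 (n : ℕ) : Set where
  field
    word   : Vec (Fin 2) (2 * n)
    zeros  : #[ 0F ] (toList word) ≡ n
    ones   : #[ 1F ] (toList word) ≡ n
    prefix : ∀ k → #[ 1F ] (take k (toList word)) ≤ #[ 0F ] (take k (toList word))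

_at_ : ∀ {n} → 𝒟 n → Fin (2 * n) → Fin 2
σ at j = lookup (𝒟.word σ) j

-- All vertices have non-negative coordinates.
Point : Set
Point = ℕ × ℕ

_≟ᴾ_ : DecidableEquality Point
_≟ᴾ_ = Product.≡-dec _≟_ _≟_

IsVertex : ℕ → Point → Set
IsVertex n (x , y) = y ≤ x × x + y ≤ 4 * n ∸ 2

isVertex? : ∀ n → Decidable (IsVertex n)
isVertex? n (x , y) = (y ≤? x) ×-dec (x + y ≤? 4 * n ∸ 2)

vertices : ℕ → List Point
vertices n = filter (isVertex? n) (cartesianProduct (upTo (4 * n)) (upTo (4 * n)))

-- The truncated subtractions in L, R, E and O are exact for 1 ≤ i ≤ 2n.
L R : ℕ → ℕ → Point
L n i = i ∸ 1 , i ∸ 1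
R n i = 2 * n ∸ 2 + i , 2 * n ∸ i

E O : ℕ → ℕ → Point → Set
E n i v@(x , y) = IsVertex n v × x + y ≡ 2 * i ∸ 2
O n i v@(x , y) = IsVertex n v × x + y ≡ 2 * i ∸ 1

E? : ∀ n i → Decidable (E n i)
E? n i v@(x , y) = isVertex? n v ×-dec (x + y ≟ 2 * i ∸ 2)

O? : ∀ n i → Decidable (O n i)
O? n i v@(x , y) = isVertex? n v ×-dec (x + y ≟ 2 * i ∸ 1)

-- hor (x , y)  joins (x , y) and (x + 1 , y);  ver (x , y)  joins (x , y)
-- and (x , y + 1);  ext i  hangs below (2i - 2 , 0).
data Edge : Set where
  hor ver : Point → Edge
  ext     : ℕ → Edge

east north : Point → Point
east  (x , y) = suc x , y
north (x , y) = x , suc y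

-- Because of the truncated subtraction,  leftOf  is only meaningful at
-- points with x ≥ 1, and  below  at points with y ≥ 1.
rightOf leftOf below : Point → Edge
rightOf v       = hor v
leftOf  (x , y) = hor (x ∸ 1 , y)
below   (x , y) = ver (x , y ∸ 1)

edges : ℕ → List Edge
edges n = map hor (filter (λ v → isVertex? n (east v)) (vertices n))
       ++ map ver (filter (λ v → isVertex? n (north v)) (vertices n))
       ++ map ext (map suc (upTo (2 * n)))

-- The enumerations have no repetitions, and the box searched by  vertices
-- is large enough.
vertices-complete : ∀ {n} → 1 ≤ n → ∀ {v} → IsVertex n v → v ∈ vertices n
vertices-complete {suc m} _ {x , y} p@(_ , x+y≤) =
  ∈-filter⁺ (isVertex? (suc m))
    (∈-cartesianProduct⁺ (∈-upTo⁺ (bound (m+n≤o⇒m≤o x x+y≤)))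
                         (∈-upTo⁺ (bound (m+n≤o⇒n≤o x x+y≤)))) p
  where
  bound : ∀ {k} → k ≤ 4 * suc m ∸ 2 → k < 4 * suc m
  bound k≤ = s≤s (≤-trans k≤ (m∸n≤m (m + 3 * suc m) 1))

vertices-unique : ∀ n → Unique (vertices n)
vertices-unique n = Unique.filter⁺ (isVertex? n)
  (Unique.cartesianProduct⁺ (Unique.upTo⁺ (4 * n)) (Unique.upTo⁺ (4 * n)))

edges-unique : ∀ n → Unique (edges n)
edges-unique n = unique _ _ _ (Unique.filter⁺ _ (vertices-unique n))
  (Unique.filter⁺ _ (vertices-unique n)) (Unique.map⁺ suc-injective (Unique.upTo⁺ (2 * n)))
  where
  disjoint₁ : ∀ as bs cs {e} → ¬ (e ∈ map hor as × e ∈ map ver bs ++ map ext cs)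
  disjoint₁ as bs cs (p , q) with ∈-map⁻ hor p | ∈-++⁻ (map ver bs) q
  ... | _ , _ , refl | inj₁ r = case ∈-map⁻ ver r of λ ()
  ... | _ , _ , refl | inj₂ r = case ∈-map⁻ ext r of λ ()

  disjoint₂ : ∀ bs cs {e} → ¬ (e ∈ map ver bs × e ∈ map ext cs)
  disjoint₂ bs cs (p , q) with ∈-map⁻ ver p
  ... | _ , _ , refl = case ∈-map⁻ ext q of λ ()

  unique : ∀ as bs cs → Unique as → Unique bs → Unique cs →
           Unique (map hor as ++ map ver bs ++ map ext cs)
  unique as bs cs ua ub uc =
    Unique.++⁺ (Unique.map⁺ (λ { refl → refl }) ua)
      (Unique.++⁺ (Unique.map⁺ (λ { refl → refl }) ub) (Unique.map⁺ (λ { refl → refl }) uc)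
        (disjoint₂ bs cs))
      (disjoint₁ as bs cs)

data Orientation : Set where
  positive negative : Orientation

pattern right = positive
pattern up    = positive
pattern left  = negative
pattern down  = negative

-- Tail and head of an oriented edge; the free end of an external edge is
-- not a vertex.
tail head : Edge → Orientation → Maybe Point
tail (hor v) right = just v
tail (hor v) left  = just (east v)
tail (ver v) up    = just v
tail (ver v) down  = just (north v)
tail (ext i) up    = nothing
tail (ext i) down  = just (2 * i ∸ 2 , 0)
head (hor v) right = just (east v)
head (hor v) left  = just v
head (ver v) up    = just (north v)
head (ver v) down  = just v
head (ext i) up    = just (2 * i ∸ 2 , 0)
head (ext i) down  = nothing

-- A subgraph of the triangle is given by its edges:  state e ≡ nothing
-- means that e does not belong to it.
record OrientedSubgraph (n : ℕ) : Set where
  field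
    state    : Edge → Maybe Orientation
    subgraph : ∀ {e d} → state e ≡ just d → e ∈ edges n

  tailOf headOf : Edge → Maybe Point
  tailOf e = state e >>= tail e
  headOf e = state e >>= head e

  indegree outdegree : Point → ℕ
  indegree  v = length (filter (λ e → Maybe.≡-dec _≟ᴾ_ (headOf e) (just v)) (edges n))
  outdegree v = length (filter (λ e → Maybe.≡-dec _≟ᴾ_ (tailOf e) (just v)) (edges n))

  FromOToE : ℕ → Edge → Set
  FromOToE i e = AnyJust (O n i) (tailOf e) × AnyJust (E n i) (headOf e)

  fromOToE? : ∀ i → Decidable (FromOToE i)
  fromOToE? i e = MaybeAny.dec (O? n i) (tailOf e) ×-dec MaybeAny.dec (E? n i) (headOf e)

  N : ℕ → ℕ
  N zero      = 0
  N i@(suc _) = length (filter (fromOToE? i) (edges n))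

-- Indices of letters are written  pos j,  the others are bare numbers i.
record OrientedTFPL (n : ℕ) (σ τ π : 𝒟 n) : Set where
  field
    graph : OrientedSubgraph n

  open OrientedSubgraph graph public

  field
    external-up   : ∀ j → π at j ≡ 0F → state (ext (pos j)) ≡ just up
    external-down : ∀ j → π at j ≡ 1F → state (ext (pos j)) ≡ just down

    L-horizontal  : ∀ i → 1 ≤ i → i ≤ 2 * n ∸ 1 → state (rightOf (L n i)) ≡ just right
    L-vertical    : ∀ j → 2 ≤ pos j → σ at j ≡ 0F → state (below (L n (pos j))) ≡ just up
    L-no-vertical : ∀ j → 2 ≤ pos j → σ at j ≢ 0F → state (below (L n (pos j))) ≡ nothing

    R-horizontal  : ∀ i → 2 ≤ i → i ≤ 2 * n → state (leftOf (R n i)) ≡ just right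
    R-vertical    : ∀ j → pos j ≤ 2 * n ∸ 1 → τ at j ≡ 1F → state (below (R n (pos j))) ≡ just down
    R-no-vertical : ∀ j → pos j ≤ 2 * n ∸ 1 → τ at j ≢ 1F → state (below (R n (pos j))) ≡ nothing

    inner : ∀ v → IsVertex n v →
            (∀ i → 1 ≤ i → i ≤ 2 * n → v ≢ L n i) →
            (∀ i → 1 ≤ i → i ≤ 2 * n → v ≢ R n i) →
            indegree v ≡ 1 × outdegree v ≡ 1

{-# OPTIONS --safe #-}

-- Count the edges of f by the diagonals x + y = const that they join.  Let
-- i ≥ 2, and let C be the number of edges from O (i - 1) to E i.  The i - 1
-- vertices of O (i - 1) all have outdegree 1, so  i - 1 = N (i - 1) + C.
-- The i - 1 vertices of E i other than L i have indegree 1 and the indegree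
-- of L i is 1 - σᵢ, so  i - σᵢ = N i + C + (1 - πᵢ), the last term being the
-- external edge; subtract.  For i = 1, all of σ₁, π₁ and N 1 vanish, the only
-- edge between O 1 and E 1 being oriented to the right.

module Submission where

open import Defs
open import Data.Empty using (⊥)
open import Data.Fin using (Fin; toℕ; zero; suc)
open import Data.Fin.Patterns using (0F; 1F)
open import Data.Integer using (+_; _-_; _⊖_)
import Data.Integer.Properties as ℤ
open import Data.List using (List; []; _∷_; cartesianProduct; filter; length; map; take; upTo)
open import Data.List.Membership.Propositional using (_∈_)
open import Data.List.Membership.Propositional.Properties
  using (∈-map⁻; ∈-++⁻; ∈-filter⁻; ∈-upTo⁻)
open import Data.List.Properties using (filter-none; filter-accept; filter-reject; filter-≐)
import Data.List.Relation.Unary.All as All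
open import Data.List.Relation.Unary.AllPairs using (_∷_)
open import Data.List.Relation.Unary.Any using (here; there)
open import Data.List.Relation.Unary.Unique.Propositional using (Unique)
open import Data.Maybe using (Maybe; just; nothing; _>>=_)
import Data.Maybe.Properties as Maybe
open import Data.Maybe.Relation.Unary.Any as MaybeAny using (just) renaming (Any to AnyJust)
open import Data.Nat using (ℕ; zero; suc; _+_; _*_; _∸_; _≤_; _<_; z≤n; s≤s; s≤s⁻¹; _<?_; _≟_)
open import Data.Nat.Properties
open import Data.Nat.Tactic.RingSolver using (solve-∀)
open import Data.Product using (_×_; _,_; proj₁; proj₂; ∃)
open import Data.Sum using (_⊎_; inj₁; inj₂)
open import Data.Vec using (Vec; _∷_; lookup; toList)
open import Relation.Binary.Definitions using (tri<; tri≈; tri>)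
open import Relation.Binary.PropositionalEquality
open import Relation.Nullary using (¬_; yes; no; contradiction)
open import Relation.Nullary.Decidable using (_×-dec_; _⊎-dec_)
open import Relation.Unary using (Pred; Decidable)

-- Counting list elements, and counting along a diagonal.

-- Bounding `y` by a parameter instead of by `x` lets an induction on `c` remove one point at a
-- time. For `c = k` the diagonal `s = 2 * k - 1` gives all of `O n k`, and `s = 2 * k` gives
-- `E n (k + 1)` without its corner `(k , k)`.
Row : ℕ → ℕ → Point → Set
Row s c (x , y) = y < c × x + y ≡ s

row? : ∀ s c → Decidable (Row s c)
row? s c (x , y) = (y <? c) ×-dec (x + y ≟ s)

module _ {a} {A : Set a} where

  count : ∀ {p} {P : Pred A p} → Decidable P → List A → ℕ
  count P? xs = length (filter P? xs)

  count-none : ∀ {p} {P : Pred A p} (P? : Decidable P) → (∀ x → ¬ P x) →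
               ∀ xs → count P? xs ≡ 0
  count-none P? ¬P xs = cong length (filter-none P? (All.universal ¬P xs))

  -- The three predicates are related only by implications, so that the filters hidden in `N` and
  -- `indegree` can be plugged in as they stand.
  count-⊎ : ∀ {p q r} {P : Pred A p} {Q : Pred A q} {R : Pred A r}
            (P? : Decidable P) (Q? : Decidable Q) (R? : Decidable R) →
            (∀ x → P x → Q x ⊎ R x) → (∀ x → Q x → P x) → (∀ x → R x → P x) →
            (∀ x → Q x → R x → ⊥) →
            ∀ xs → count P? xs ≡ count Q? xs + count R? xs
  count-⊎ P? Q? R? split inˡ inʳ disj [] = refl
  count-⊎ P? Q? R? split inˡ inʳ disj (x ∷ xs)
    with ih ← count-⊎ P? Q? R? split inˡ inʳ disj xs | P? x | Q? x | R? x
  ... | _     | yes q | yes r = contradiction r (disj x q)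
  ... | yes _ | yes _ | no _  = cong suc ih
  ... | yes _ | no _  | yes _ = trans (cong suc ih) (sym (+-suc _ _))
  ... | no _  | no _  | no _  = ih
  ... | yes p | no ¬q | no ¬r with split x p
  ...   | inj₁ q = contradiction q ¬q
  ...   | inj₂ r = contradiction r ¬r
  count-⊎ P? Q? R? split inˡ inʳ disj (x ∷ xs)
      | no ¬p | yes q | _     = contradiction (inˡ x q) ¬p
  count-⊎ P? Q? R? split inˡ inʳ disj (x ∷ xs)
      | no ¬p | _     | yes r = contradiction (inʳ x r) ¬p

  count-unique : ∀ {p} {P : Pred A p} (P? : Decidable P) {x₀} →
                 (∀ x → P x → x ≡ x₀) → P x₀ →
                 ∀ {xs} → Unique xs → x₀ ∈ xs → count P? xs ≡ 1
  count-unique P? only p (≢xs ∷ u) (here refl) =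
    cong length (trans (filter-accept P? p)
      (cong (_ ∷_) (filter-none P? (All.map (λ ≢x px → ≢x (sym (only _ px))) ≢xs))))
  count-unique P? only p (≢xs ∷ u) (there x₀∈xs) =
    trans (cong length (filter-reject P? (λ px → All.lookup ≢xs x₀∈xs (only _ px))))
          (count-unique P? only p u x₀∈xs)

  _hits?_ : (h : A → Maybe Point) (v : Point) → Decidable (λ e → h e ≡ just v)
  (h hits? v) e = Maybe.≡-dec _≟ᴾ_ (h e) (just v)

  -- Induction on `c`: each `h e` is at most one point, so the elements sent to the topmost point
  -- `(s ∸ c , c)` split off disjointly and contribute 1. The bound on `c` makes that subtraction
  -- exact. With `tailOf` and `headOf` for `h`, the hypothesis concerns outdegrees and indegrees.
  count-row : (h : A → Maybe Point) (xs : List A) (s c : ℕ) → c ≤ suc s →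
              (∀ x y → Row s c (x , y) → count (h hits? (x , y)) xs ≡ 1) →
              count (λ e → MaybeAny.dec (row? s c) (h e)) xs ≡ c
  count-row h xs s zero _ _ =
    count-none _ (λ e a → noRow (h e) a) xs
    where
    noRow : ∀ m → ¬ AnyJust (Row s 0) m
    noRow (just _) (just (() , _))
  count-row h xs s (suc c) c<s once =
    trans (count-⊎ _ (h hits? (s ∸ c , c)) (λ e → MaybeAny.dec (row? s c) (h e))
             (λ e → split (h e)) (λ e → top (h e)) (λ e → weaken (h e)) (λ e → disjoint (h e)) xs)
          (cong₂ _+_ (once _ _ (≤-refl , s∸c+c))
             (count-row h xs s c (m≤n⇒m≤1+n (s≤s⁻¹ c<s))
                (λ x y (y<c , eq) → once x y (m≤n⇒m≤1+n y<c , eq))))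
    where
    s∸c+c : s ∸ c + c ≡ s
    s∸c+c = m∸n+n≡m (s≤s⁻¹ c<s)

    split : ∀ m → AnyJust (Row s (suc c)) m → m ≡ just (s ∸ c , c) ⊎ AnyJust (Row s c) m
    split (just (x , y)) (just (y<1+c , eq)) with m≤n⇒m<n∨m≡n (s≤s⁻¹ y<1+c)
    ... | inj₁ y<c  = inj₂ (just (y<c , eq))
    ... | inj₂ refl = inj₁ (cong (λ z → just (z , y)) (trans (sym (m+n∸n≡m x y)) (cong (_∸ y) eq)))

    top : ∀ m → m ≡ just (s ∸ c , c) → AnyJust (Row s (suc c)) m
    top _ refl = just (≤-refl , s∸c+c)

    weaken : ∀ m → AnyJust (Row s c) m → AnyJust (Row s (suc c)) m
    weaken _ (just (y<c , eq)) = just (m≤n⇒m≤1+n y<c , eq)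

    disjoint : ∀ m → m ≡ just (s ∸ c , c) → AnyJust (Row s c) m → ⊥
    disjoint _ refl (just (c<c , _)) = n≮n _ c<c

-- Edges, boundary vertices and the coordinate sum.

2*[1+k]∸1 : ∀ k → 2 * suc k ∸ 1 ≡ suc (2 * k)
2*[1+k]∸1 k = cong (_∸ 1) (*-suc 2 k)

2*[1+k]∸2 : ∀ k → 2 * suc k ∸ 2 ≡ 2 * k
2*[1+k]∸2 k = cong (_∸ 2) (*-suc 2 k)

k+k≡2*k : ∀ k → k + k ≡ 2 * k
k+k≡2*k k = cong (_+_ k) (sym (+-identityʳ k))

deg : Point → ℕ
deg (x , y) = x + y

IsEdge : ℕ → Edge → Set
IsEdge n (hor v) = IsVertex n v × IsVertex n (east v)
IsEdge n (ver v) = IsVertex n v × IsVertex n (north v)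
IsEdge n (ext i) = ∃ λ k → k < 2 * n × i ≡ suc k

∈-edges⁻ : ∀ n {e} → e ∈ edges n → IsEdge n e
∈-edges⁻ n e∈ with ∈-++⁻ (map hor (filter (λ v → isVertex? n (east v)) (vertices n))) e∈
... | inj₁ e∈h with v , v∈ , refl ← ∈-map⁻ hor e∈h
               with v∈′ , east-v ← ∈-filter⁻ (λ v → isVertex? n (east v)) {xs = vertices n} v∈ =
  proj₂ (∈-filter⁻ (isVertex? n) {xs = cartesianProduct (upTo (4 * n)) (upTo (4 * n))} v∈′) , east-v
... | inj₂ e∈′ with ∈-++⁻ (map ver (filter (λ v → isVertex? n (north v)) (vertices n))) e∈′
...   | inj₁ e∈v with v , v∈ , refl ← ∈-map⁻ ver e∈v
                 with v∈′ , north-v ← ∈-filter⁻ (λ v → isVertex? n (north v)) {xs = vertices n} v∈ =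
  proj₂ (∈-filter⁻ (isVertex? n) {xs = cartesianProduct (upTo (4 * n)) (upTo (4 * n))} v∈′) , north-v
...   | inj₂ e∈x with i , i∈ , refl ← ∈-map⁻ ext e∈x
                 with k , k∈ , refl ← ∈-map⁻ suc i∈ = k , ∈-upTo⁻ k∈ , refl

-- Otherwise `x ≤ y ≤ m`, and the sum would be at most `2 * m`.
below-diagonal : ∀ {m x y} → y < suc m → 2 * m < x + y → y < x
below-diagonal {m} y≤m 2m< = ≰⇒> λ x≤y →
  <⇒≱ 2m< (≤-trans (+-mono-≤ (≤-trans x≤y (s≤s⁻¹ y≤m)) (s≤s⁻¹ y≤m)) (≤-reflexive (k+k≡2*k m)))

-- All that the counting needs to know of an oriented edge: it changes `x + y` by exactly one, or it
-- is external and its only vertex has even `x + y`.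
data Arc (n : ℕ) : Maybe Point → Maybe Point → Set where
  inc : ∀ {t h} → IsVertex n t → IsVertex n h → deg h ≡ suc (deg t) → Arc n (just t) (just h)
  dec : ∀ {t h} → IsVertex n t → IsVertex n h → deg t ≡ suc (deg h) → Arc n (just t) (just h)
  enter : ∀ k → Arc n nothing (just (2 * k , 0))
  leave : ∀ k → Arc n (just (2 * k , 0)) nothing

arc : ∀ {n} e d → IsEdge n e → Arc n (tail e d) (head e d)
arc (hor (x , y)) right (v , w) = inc v w refl
arc (hor (x , y)) left  (v , w) = dec w v refl
arc (ver (x , y)) up    (v , w) = inc v w (+-suc x y)
arc (ver (x , y)) down  (v , w) = dec w v (+-suc x y)
arc {n} (ext _) up   (k , _ , refl) rewrite 2*[1+k]∸2 k = enter k
arc {n} (ext _) down (k , _ , refl) rewrite 2*[1+k]∸2 k = leave k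

-- A leading 1 would violate the prefix condition at length 1.
starts-with-0 : ∀ {n} (σ : 𝒟 n) (j : Fin (2 * n)) → toℕ j ≡ 0 → σ at j ≡ 0F
starts-with-0 {n} σ j eq = go (𝒟.word σ) (𝒟.prefix σ 1) j eq
  where
  go : ∀ {m} (w : Vec (Fin 2) m) → #[ 1F ] (take 1 (toList w)) ≤ #[ 0F ] (take 1 (toList w)) →
       (j : Fin m) → toℕ j ≡ 0 → lookup w j ≡ 0F
  go (0F ∷ _) _ zero _ = refl
  go (1F ∷ _) () zero _

-- The index `i` cancels, so the right boundary is contained in the last diagonal; any smaller
-- coordinate sum therefore excludes it.
deg-R : ∀ n → 1 ≤ n → ∀ i → i ≤ 2 * n → deg (R n i) ≡ 2 * (2 * n ∸ 1)
deg-R (suc m) _ i i≤2n = begin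
  (2 * n ∸ 2 + i) + (2 * n ∸ i) ≡⟨ +-assoc (2 * n ∸ 2) i _ ⟩
  2 * n ∸ 2 + (i + (2 * n ∸ i)) ≡⟨ cong (_+_ (2 * n ∸ 2)) (m+[n∸m]≡n i≤2n) ⟩
  2 * n ∸ 2 + 2 * n             ≡⟨ cong₂ _+_ (2*[1+k]∸2 m) (*-suc 2 m) ⟩
  2 * m + (2 + 2 * m)           ≡⟨ identity m ⟩
  2 * suc (2 * m)               ≡⟨ cong (2 *_) (2*[1+k]∸1 m) ⟨
  2 * (2 * n ∸ 1)               ∎
  where
  open ≡-Reasoning
  n = suc m
  identity : ∀ m → 2 * m + (2 + 2 * m) ≡ 2 * suc (2 * m)
  identity = solve-∀

4*n∸2 : ∀ n → 4 * n ∸ 2 ≡ 2 * (2 * n ∸ 1)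
4*n∸2 n = trans (cong (_∸ 2) (*-assoc 2 2 n)) (sym (*-distribˡ-∸ 2 (2 * n) 1))

-- Edges of a fixed configuration between neighbouring diagonals.

module _ {n : ℕ} (1≤n : 1 ≤ n) {σ τ π : 𝒟 n} (f : OrientedTFPL n σ τ π) where
  open OrientedTFPL f

  arcOf : ∀ e {d} → state e ≡ just d → IsEdge n e
  arcOf e eq = ∈-edges⁻ n (subgraph eq)

  arcs : ∀ e → (tailOf e ≡ nothing × headOf e ≡ nothing) ⊎ Arc n (tailOf e) (headOf e)
  arcs e with state e in eq
  ... | nothing = inj₁ (refl , refl)
  ... | just d  = inj₂ (arc e d (arcOf e eq))

  -- Every `L n i` has equal coordinates and every `R n i` lies on the last diagonal, so the two
  -- strict inequalities exclude both boundaries and `inner` applies.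
  interior : ∀ {x y} → y < x → x + y < 2 * (2 * n ∸ 1) →
             indegree (x , y) ≡ 1 × outdegree (x , y) ≡ 1
  interior {x} {y} y<x deg< =
    inner (x , y) (<⇒≤ y<x , subst (x + y ≤_) (sym (4*n∸2 n)) (<⇒≤ deg<))
      (λ _ _ _ eq → <⇒≢ y<x (trans (cong proj₂ eq) (sym (cong proj₁ eq))))
      (λ i _ i≤2n eq → <⇒≢ deg< (trans (cong deg eq) (deg-R n 1≤n i i≤2n)))

  module _ {m : ℕ} {j : Fin (2 * n)} (toℕj : toℕ j ≡ suc m) (i≤ : suc (suc m) ≤ 2 * n ∸ 1) where
    -- Here `toℕ j` is `k`, so `pos j` is `i`, and `L n i` is the point `(k , k)`.
    k i : ℕ
    k = suc m
    i = suc k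

    deg-O : 2 * k ∸ 1 ≡ suc (2 * m)
    deg-O = 2*[1+k]∸1 m

    deg-E : 2 * i ∸ 2 ≡ 2 * k
    deg-E = 2*[1+k]∸2 k

    -- The restriction to `i ≤ 2 * n ∸ 1` keeps `E n i`, and with it `O n k`, off the right
    -- boundary.
    2k<top : 2 * k < 2 * (2 * n ∸ 1)
    2k<top = *-monoʳ-< 2 i≤

    1+2m<2k : suc (2 * m) < 2 * k
    1+2m<2k = ≤-reflexive (sym (*-suc 2 m))

    isVertex : ∀ {x y} → y ≤ x → x + y ≤ 2 * k → IsVertex n (x , y)
    isVertex y≤x ≤2k = y≤x , ≤-trans ≤2k (subst (2 * k ≤_) (sym (4*n∸2 n)) (<⇒≤ 2k<top))

    intoE? : Decidable (λ e → AnyJust (E n i) (headOf e))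
    intoE? e = MaybeAny.dec (E? n i) (headOf e)

    outOfO? : Decidable (λ e → AnyJust (O n k) (tailOf e))
    outOfO? e = MaybeAny.dec (O? n k) (tailOf e)

    O→E? : Decidable (λ e → AnyJust (O n k) (tailOf e) × AnyJust (E n i) (headOf e))
    O→E? e = outOfO? e ×-dec intoE? e

    enters? : Decidable (λ e → tailOf e ≡ nothing × AnyJust (E n i) (headOf e))
    enters? e = Maybe.≡-dec _≟ᴾ_ (tailOf e) nothing ×-dec intoE? e

    -- Treats both diagonals at once: `s` can only be `2 * k - 1` or `2 * k`. The lower bound gives
    -- `y < x`, the upper bound avoids the last diagonal.
    interior-row : ∀ {x y} s → suc (2 * m) ≤ s → s ≤ 2 * k → Row s k (x , y) →
                   indegree (x , y) ≡ 1 × outdegree (x , y) ≡ 1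
    interior-row s 2m<s s≤2k (y<k , refl) =
      interior (below-diagonal y<k 2m<s) (≤-<-trans s≤2k 2k<top)

    outOfO-count : count outOfO? (edges n) ≡ k
    outOfO-count =
      trans (cong length (filter-≐ outOfO? (λ e → MaybeAny.dec (row? s k) (tailOf e))
               ((λ {e} → to (tailOf e)) , λ {e} → from (tailOf e)) (edges n)))
            (count-row tailOf (edges n) s k k≤1+s
               (λ x y r → proj₂ (interior-row s ≤-refl (<⇒≤ 1+2m<2k) r)))
      where
      s = suc (2 * m)
      k≤1+s : k ≤ suc s
      k≤1+s = s≤s (m≤n⇒m≤1+n (m≤n*m m 2))
      to : ∀ t → AnyJust (O n k) t → AnyJust (Row s k) t
      to (just (x , y)) (just ((y≤x , _) , eq)) with deg≡ ← trans eq deg-O | y <? k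
      ... | yes y<k = just (y<k , deg≡)
      -- If `k ≤ y ≤ x`, the sum would be at least `2 * k`, but on `O n k` it is `2 * k - 1`.
      ... | no ¬y<k = contradiction (≤-trans (≤-reflexive (sym (k+k≡2*k k))) (+-mono-≤ (≤-trans k≤y y≤x) k≤y))
                                    (<⇒≱ (subst (_< 2 * k) (sym deg≡) 1+2m<2k))
        where k≤y = ≮⇒≥ ¬y<k
      from : ∀ t → AnyJust (Row s k) t → AnyJust (O n k) t
      from (just (x , y)) (just (y<k , eq)) =
        just (isVertex (<⇒≤ (below-diagonal y<k (≤-reflexive (sym eq))))
                       (≤-trans (≤-reflexive eq) (<⇒≤ 1+2m<2k))
             , trans eq (sym deg-O))

    -- The corner `(k , k)` is `L n i`, to which `inner` does not apply; its indegree is left open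
    -- here and is found in `L-count`.
    intoE-count : count intoE? (edges n) ≡ indegree (k , k) + k
    intoE-count =
      trans (count-⊎ intoE? (headOf hits? (k , k)) (λ e → MaybeAny.dec (row? (2 * k) k) (headOf e))
               (λ e → split (headOf e)) (λ e → corner (headOf e)) (λ e → from (headOf e))
               (λ e → disjoint (headOf e)) (edges n))
            (cong (_+_ (indegree (k , k)))
               (count-row headOf (edges n) (2 * k) k (m≤n⇒m≤1+n (m≤n*m k 2))
                  (λ x y r → proj₁ (interior-row (2 * k) (<⇒≤ 1+2m<2k) ≤-refl r))))
      where
      split : ∀ h → AnyJust (E n i) h → h ≡ just (k , k) ⊎ AnyJust (Row (2 * k) k) h
      split (just (x , y)) (just ((y≤x , _) , eq)) with deg≡ ← trans eq deg-E | <-cmp y k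
      ... | tri< y<k _ _ = inj₂ (just (y<k , deg≡))
      ... | tri≈ _ refl _ =
        inj₁ (cong (λ x → just (x , k)) (+-cancelʳ-≡ k x k (trans deg≡ (sym (k+k≡2*k k)))))
      ... | tri> _ _ k<y = contradiction (trans (k+k≡2*k k) (sym deg≡))
                                         (<⇒≢ (+-mono-< (<-≤-trans k<y y≤x) k<y))
      corner : ∀ h → h ≡ just (k , k) → AnyJust (E n i) h
      corner _ refl = just (isVertex ≤-refl (≤-reflexive (k+k≡2*k k)) , trans (k+k≡2*k k) (sym deg-E))
      from : ∀ h → AnyJust (Row (2 * k) k) h → AnyJust (E n i) h
      from (just (x , y)) (just (y<k , eq)) =
        just (isVertex (<⇒≤ (below-diagonal y<k (≤-trans (<⇒≤ 1+2m<2k) (≤-reflexive (sym eq)))))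
                       (≤-reflexive eq)
             , trans eq (sym deg-E))
      disjoint : ∀ h → h ≡ just (k , k) → AnyJust (Row (2 * k) k) h → ⊥
      disjoint _ refl (just (k<k , _)) = n≮n k k<k

    -- A step of one from the sum `2 * k - 1` ends in `E n k` or in `E n i`. No external edge can
    -- start on `O n k`, by parity.
    outOfO-split : count outOfO? (edges n) ≡ N k + count O→E? (edges n)
    outOfO-split = count-⊎ outOfO? (fromOToE? k) O→E?
      split (λ _ → proj₁) (λ _ → proj₁)
      (λ e (_ , a) (_ , b) → disjoint (headOf e) a b) (edges n)
      where
      byArc : ∀ {t h} → Arc n t h → AnyJust (O n k) t →
              AnyJust (O n k) t × AnyJust (E n k) h ⊎ AnyJust (O n k) t × AnyJust (E n i) h
      byArc (inc _ vh eq) o@(just (_ , deg-t)) =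
        inj₂ (o , just (vh , trans eq (trans (cong suc (trans deg-t deg-O)) (sym (trans deg-E (*-suc 2 m))))))
      byArc (dec _ vh eq) o@(just (_ , deg-t)) =
        inj₁ (o , just (vh , trans (suc-injective (trans (sym eq) (trans deg-t deg-O))) (sym (2*[1+k]∸2 m))))
      byArc (leave l) (just (_ , deg-t)) =
        contradiction (trans (sym (+-identityʳ (2 * l))) (trans deg-t deg-O)) (even≢odd l m)

      split : ∀ e → AnyJust (O n k) (tailOf e) →
              FromOToE k e ⊎ AnyJust (O n k) (tailOf e) × AnyJust (E n i) (headOf e)
      split e o with arcs e
      ... | inj₂ a = byArc a o
      ... | inj₁ (t≡nothing , _) with () ← subst (AnyJust (O n k)) t≡nothing o

      disjoint : ∀ h → AnyJust (E n k) h → AnyJust (E n i) h → ⊥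
      disjoint _ (just (_ , eq)) (just (_ , eq′)) =
        <⇒≢ ≤-refl (*-cancelˡ-≡ m k 2 (trans (sym (2*[1+k]∸2 m)) (trans (sym eq) (trans eq′ deg-E))))

    -- An edge with its head in `E n i` comes from the diagonal above, from the one below, or has no
    -- tail because it is external.
    intoE-split : count intoE? (edges n) ≡
                  N i + (count O→E? (edges n) + count enters? (edges n))
    intoE-split =
      trans (count-⊎ intoE? (fromOToE? i) (λ e → O→E? e ⊎-dec enters? e)
               split (λ _ → proj₂) (λ { _ (inj₁ a) → proj₂ a ; _ (inj₂ b) → proj₂ b })
               (λ { e (a , _) (inj₁ (b , _)) → disjoint (tailOf e) a b
                  ; e (a , _) (inj₂ (b , _)) → empty (tailOf e) a b }) (edges n))
            (cong (_+_ (N i)) (count-⊎ (λ e → O→E? e ⊎-dec enters? e) O→E? enters?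
               (λ _ → λ a → a) (λ _ → inj₁) (λ _ → inj₂)
               (λ e (a , _) (b , _) → empty (tailOf e) a b) (edges n)))
      where
      To : Maybe Point → Maybe Point → Set
      To t h = AnyJust (O n i) t × AnyJust (E n i) h ⊎
               (AnyJust (O n k) t × AnyJust (E n i) h ⊎ t ≡ nothing × AnyJust (E n i) h)

      byArc : ∀ {t h} → Arc n t h → AnyJust (E n i) h → To t h
      byArc (inc vt _ eq) a@(just (_ , deg-h)) =
        inj₂ (inj₁ (just (vt , trans (suc-injective (trans (sym eq) (trans deg-h (trans deg-E (*-suc 2 m)))))
                                     (sym deg-O)) , a))
      byArc (dec vt _ eq) a@(just (_ , deg-h)) =
        inj₁ (just (vt , trans eq (trans (cong suc (trans deg-h deg-E)) (sym (2*[1+k]∸1 k)))) , a)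
      byArc (enter _) a = inj₂ (inj₂ (refl , a))

      split : ∀ e → AnyJust (E n i) (headOf e) → To (tailOf e) (headOf e)
      split e a with arcs e
      ... | inj₂ p = byArc p a
      ... | inj₁ (_ , h≡nothing) with () ← subst (AnyJust (E n i)) h≡nothing a

      disjoint : ∀ t → AnyJust (O n i) t → AnyJust (O n k) t → ⊥
      disjoint _ (just (_ , eq)) (just (_ , eq′)) =
        <⇒≢ ≤-refl (*-cancelˡ-≡ m k 2 (suc-injective
          (trans (sym deg-O) (trans (sym eq′) (trans eq (2*[1+k]∸1 k))))))

      empty : ∀ {p} {P : Pred Point p} t → AnyJust P t → t ≡ nothing → ⊥
      empty _ (just _) ()

    -- Among edges of the subgraph only an external one oriented upwards lacks a tail, and its head
    -- `(2 * l , 0)` lies on `E n i` only for `l = k`.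
    enters⁻ : ∀ e → tailOf e ≡ nothing → AnyJust (E n i) (headOf e) →
              e ≡ ext (pos j) × state e ≡ just up
    enters⁻ e t h with state e in eq
    enters⁻ (hor _) () h | just right
    enters⁻ (hor _) () h | just left
    enters⁻ (ver _) () h | just up
    enters⁻ (ver _) () h | just down
    enters⁻ (ext _) () h | just down
    enters⁻ (ext _) _ (just (_ , deg≡)) | just up with l , _ , refl ← arcOf _ eq =
      cong (λ l → ext (suc l)) (trans (*-cancelˡ-≡ l k 2 (trans (sym (2*[1+k]∸2 l))
        (trans (sym (+-identityʳ _)) (trans deg≡ deg-E)))) (sym toℕj)) , refl

    -- Letters are at most 1, so `1 ∸` is exact and serves as the indicator of the letter 0.
    enters-count : count enters? (edges n) ≡ 1 ∸ toℕ (π at j)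
    enters-count with π at j in πj
    ... | 0F = count-unique enters? (λ e (t , h) → proj₁ (enters⁻ e t h))
                 entering (edges-unique n) (subgraph is-up)
      where
      is-up = external-up j πj
      entering : tailOf (ext (pos j)) ≡ nothing × AnyJust (E n i) (headOf (ext (pos j)))
      entering rewrite is-up | toℕj =
        refl , just (isVertex z≤n (≤-reflexive deg≡) , +-identityʳ _)
        where deg≡ = trans (+-identityʳ _) deg-E
    ... | 1F = count-none enters? (λ e (t , h) → notDown (enters⁻ e t h)) (edges n)
      where
      notDown : ∀ {e} → e ≡ ext (pos j) × state e ≡ just up → ⊥
      notDown (refl , eq) with () ← trans (sym (external-down j πj)) eq

    -- The other edges that could end at the corner fail: the one from the left would start at
    -- `(m , k)` and the one from above at `(k , suc k)`, which are not vertices; the one on the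
    -- right is oriented away by `L-horizontal`; external edges end at height 0.
    intoL⁻ : ∀ e → headOf e ≡ just (k , k) → e ≡ ver (k , m) × state e ≡ just up
    intoL⁻ e h with state e in eq
    intoL⁻ (hor _) refl | just right with (k≤m , _) , _ ← arcOf _ eq = contradiction k≤m (n≮n m)
    intoL⁻ (hor _) refl | just left
      with () ← trans (sym eq) (L-horizontal i (s≤s z≤n) i≤)
    intoL⁻ (ver _) refl | just up = refl , refl
    intoL⁻ (ver _) refl | just down with _ , (k<k , _) ← arcOf _ eq = contradiction k<k (n≮n k)

    L-count : indegree (k , k) ≡ 1 ∸ toℕ (σ at j)
    L-count with σ at j in σj
    ... | 0F = count-unique (headOf hits? (k , k)) (λ e h → proj₁ (intoL⁻ e h))
                 (cong (_>>= head (ver (k , m))) is-up) (edges-unique n) (subgraph is-up)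
      where
      is-up : state (ver (k , m)) ≡ just up
      -- `L n (pos j)` computes to `(toℕ j , toℕ j)`, so only `toℕ j` has to be replaced by `k`.
      is-up = subst (λ l → state (ver (l , l ∸ 1)) ≡ just up) toℕj
                (L-vertical j (s≤s (subst (1 ≤_) (sym toℕj) (s≤s z≤n))) σj)
    ... | 1F = count-none (headOf hits? (k , k)) (λ e h → absent (intoL⁻ e h)) (edges n)
      where
      no-edge : state (ver (k , m)) ≡ nothing
      no-edge = subst (λ l → state (ver (l , l ∸ 1)) ≡ nothing) toℕj
                  (L-no-vertical j (s≤s (subst (1 ≤_) (sym toℕj) (s≤s z≤n)))
                     (λ eq → contradiction (trans (sym σj) eq) λ ()))
      absent : ∀ {e} → e ≡ ver (k , m) × state e ≡ just up → ⊥
      absent (refl , eq) with () ← trans (sym no-edge) eq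

    -- The two counts are joined by replacing `k` with `N k + C`, after which `C` cancels. Keeping a
    -- complemented letter on each side means that nothing has to be subtracted in the natural
    -- numbers.
    N-step : (1 ∸ toℕ (σ at j)) + N k ≡ N i + (1 ∸ toℕ (π at j))
    N-step = +-cancelʳ-≡ C _ _ (begin
      ((1 ∸ toℕ (σ at j)) + N k) + C       ≡⟨ +-assoc (1 ∸ toℕ (σ at j)) (N k) C ⟩
      (1 ∸ toℕ (σ at j)) + (N k + C)       ≡⟨ cong₂ _+_ L-count (trans (sym outOfO-count) outOfO-split) ⟨
      indegree (k , k) + k                 ≡⟨ intoE-count ⟨
      count intoE? (edges n)               ≡⟨ intoE-split ⟩
      N i + (C + count enters? (edges n))  ≡⟨ cong (λ c → N i + (C + c)) enters-count ⟩
      N i + (C + (1 ∸ toℕ (π at j)))       ≡⟨ cong (_+_ (N i)) (+-comm C _) ⟩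
      N i + ((1 ∸ toℕ (π at j)) + C)       ≡⟨ +-assoc (N i) _ C ⟨
      (N i + (1 ∸ toℕ (π at j))) + C       ∎)
      where
      open ≡-Reasoning
      C = count O→E? (edges n)

  N-one : 1 ≤ 2 * n ∸ 1 → N 1 ≡ 0
  N-one 1≤ = count-none (fromOToE? 1) none (edges n)
    where
    none : ∀ e → ¬ FromOToE 1 e
    none e (t , h) with state e in eq
    none (hor _) (just _ , just (_ , deg≡)) | just right with () ← deg≡
    -- The head has coordinate sum 0, so it can only be the origin, which is `L n 1`.
    none (hor (zero , zero)) (just _ , just _) | just left
      with () ← trans (sym eq) (L-horizontal 1 ≤-refl 1≤)
    none (ver _) (just _ , just (_ , deg≡)) | just up with () ← trans (sym (+-suc _ _)) deg≡
    -- The tail would be `(0 , 1)`, which violates `y ≤ x`.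
    none (ver (zero , zero)) (just ((() , _) , _) , just _) | just down
    none (ext _) (() , _) | just up
    none (ext _) (_ , ()) | just down

-- From complemented letters to differences of integers.

a+d≡c+b⇒a-b≡c-d : ∀ a b c d → a + d ≡ c + b → + a - + b ≡ + c - + d
a+d≡c+b⇒a-b≡c-d a b c d eq = begin
  + a - + b                 ≡⟨ ℤ.m-n≡m⊖n a b ⟩
  a ⊖ b                     ≡⟨ ℤ.+-cancelˡ-⊖ d a b ⟨
  (d + a) ⊖ (d + b)         ≡⟨ cong₂ _⊖_ (trans (+-comm d a) (trans eq (+-comm c b))) (+-comm d b) ⟩
  (b + c) ⊖ (b + d)         ≡⟨ ℤ.+-cancelˡ-⊖ b c d ⟩
  c ⊖ d                     ≡⟨ ℤ.m-n≡m⊖n c d ⟨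
  + c - + d                 ∎
  where open ≡-Reasoning

-- This amounts to adding both letters to each side and cancelling 1; for concrete letters each
-- `1 ∸ toℕ` computes.
uncomplement : ∀ (s p : Fin 2) {a b} → (1 ∸ toℕ s) + b ≡ a + (1 ∸ toℕ p) → a + toℕ s ≡ toℕ p + b
uncomplement 0F 0F {a} eq = trans (+-identityʳ a) (sym (suc-injective (trans eq (+-comm a 1))))
uncomplement 0F 1F eq = sym eq
uncomplement 1F 0F {a} eq = sym eq
uncomplement 1F 1F {a} eq = trans (+-comm a 1) (cong suc (sym (trans eq (+-identityʳ a))))

lemma4p5 : ∀ (n : ℕ) → 1 ≤ n → (σ τ π : 𝒟 n) (f : OrientedTFPL n σ τ π) →
    (j : Fin (2 * n)) → pos j ≤ 2 * n ∸ 1 →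
    (+ OrientedTFPL.N f (pos j)) - (+ OrientedTFPL.N f (pos j ∸ 1)) ≡ (+ toℕ (π at j)) - (+ toℕ (σ at j))
lemma4p5 n 1≤n σ τ π f j j≤ = a+d≡c+b⇒a-b≡c-d _ _ (toℕ (π at j)) (toℕ (σ at j)) (step (toℕ j) refl j≤)
  where
  open OrientedTFPL f using (N)
  -- The claim with its subtractions moved across. The separate `k` permits the case split on the
  -- value of `toℕ j`.
  step : ∀ k → toℕ j ≡ k → suc k ≤ 2 * n ∸ 1 → N (suc (toℕ j)) + toℕ (σ at j) ≡ toℕ (π at j) + N (toℕ j)
  -- Both first letters are 0 and `N 0` is 0 by definition, so `N 1 ≡ 0` is all that remains.
  step zero eq 1≤ rewrite starts-with-0 σ j eq | starts-with-0 π j eq | eq =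
    trans (+-identityʳ _) (N-one 1≤n f 1≤)
  step (suc m) eq i≤ =
    subst (λ l → N (suc l) + toℕ (σ at j) ≡ toℕ (π at j) + N l) (sym eq)
      (uncomplement (σ at j) (π at j) (N-step 1≤n f eq i≤))
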